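{- For every total Boolean function $g:\{0,1\}^m \to \{0,1\}$, $$\mathsf{RS}(g)=\widetilde{\Omega}(\mathsf{D}^{\mathsf{prod}}(g)).$$
   Context: A deterministic decision tree on $m$ variables is a binary tree whose internal nodes are labelled by variables $x_i$ ($i\in[m]$) with two children for $x_i=0$ and $x_i=1$; it is run on an input $x\in\{0,1\}^m$ by following the path from the root determined by the queried values. Its depth is its cost. A randomized decision tree is a probability distribution over deterministic decision trees; its query complexity is the maximum depth of a tree in its support. For a distribution $\mu$ on $\{0,1\}^m$ and $\epsilon\in[0,1/2]$, $\mathsf{D}^\mu_\epsilon(g)$ is the minimum depth of a deterministic decision tree $T$ (with leaves labelled by bits) such that $\Pr_{x\sim\mu}[T(x)\neq g(x)]\le\epsilon$. A distribution $\mu$ on $\{0,1\}^m$ is a product distribution if there are $p_1,\dots,p_m\in[0,1]$ such that each $x_i$ is independently $1$ with probability $p_i$; $\mathsf{PROD}$ denotes the set of product distributions. $\mathsf{D}^{\mathsf{prod}}_\epsilon(g):=\max_{\mu\in\mathsf{PROD}}\mathsf{D}^\mu_\epsilon(g)$ and $\mathsf{D}^{\mathsf{prod}}(g):=\mathsf{D}^{\mathsf{prod}}_{1/3}(g)$. The sabotage complexity $\mathsf{RS}_\epsilon(g)$ is the minimum query complexity of a randomized decision tree $\mathcal{R}$ such that for every $x\in g^{ -1}(0)$ and $y\in g^{ -1}(1)$, with probability at least $1-\epsilon$ a tree $T$ drawn from $\mathcal{R}$, when run on $x$, queries some index $i$ with $x_i\neq y_i$; $\mathsf{RS}(g):=\mathsf{RS}_{1/3}(g)$.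 The notation $\widetilde{\Omega}$ hides polylogarithmic factors.
   Formalization: The parameters p_i of product distributions and the probabilities in randomized decision trees are rational instead of real; by density and by rationality of linear-program solutions this does not change the values of D^prod(g) and RS(g). -}

module Defs where

open import Data.Bool using (Bool; true; false; if_then_else_)
open import Data.Nat as ℕ using (ℕ; zero; suc; _⊔_)
open import Data.Fin using (Fin)
open import Data.Vec using (Vec; []; _∷_; lookup)
open import Data.List using (List; []; _∷_; _++_; map; foldr)
open import Data.List.Relation.Unary.All using (All)
open import Data.List.Relation.Unary.Any using (Any)
open import Data.Product using (Σ; _×_; ∃; _,_; proj₁; proj₂)
open import Data.Integer using (+_)
open import Data.Rational using (ℚ; 0ℚ; 1ℚ; _+_; _*_; _-_; _≤_; _<_; _/_)
open import Relation.Binary.PropositionalEquality using (_≡_; _≢_)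
open import Relation.Nullary using (¬_)

Input : ℕ → Set
Input m = Vec Bool m

BoolFun : ℕ → Set
BoolFun m = Input m → Bool

allInputs : (m : ℕ) → List (Input m)
allInputs zero = [] ∷ []
allInputs (suc m) = map (false ∷_) (allInputs m) ++ map (true ∷_) (allInputs m)

data DTree (m : ℕ) : Set where
  leaf : Bool → DTree m
  node : Fin m → DTree m → DTree m → DTree m

depth : ∀ {m} → DTree m → ℕ
depth (leaf _) = 0
depth (node _ t₀ t₁) = suc (depth t₀ ⊔ depth t₁)

run : ∀ {m} → DTree m → Input m → Bool
run (leaf b) x = b
run (node i t₀ t₁) x = if lookup x i then run t₁ x else run t₀ x

queried : ∀ {m} → DTree m → Input m → List (Fin m)
queried (leaf _) x = []
queried (node i t₀ t₁) x = i ∷ (if lookup x i then queried t₁ x else queried t₀ x)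

sumℚ : List ℚ → ℚ
sumℚ = foldr _+_ 0ℚ

differ : Bool → Bool → ℚ
differ false false = 0ℚ
differ true true = 0ℚ
differ _ _ = 1ℚ

oneThird twoThirds : ℚ
oneThird = + 1 / 3
twoThirds = + 2 / 3

-- Product distributions: p_i = Pr[x_i = 1], each in [0,1].

ProdDist : ℕ → Set
ProdDist m = Σ (Vec ℚ m) (λ p → All (λ q → (0ℚ ≤ q) × (q ≤ 1ℚ)) (Data.Vec.toList p))

probVec : ∀ {m} → Vec ℚ m → Input m → ℚ
probVec [] [] = 1ℚ
probVec (p ∷ ps) (true ∷ xs) = p * probVec ps xs
probVec (p ∷ ps) (false ∷ xs) = (1ℚ - p) * probVec ps xs

errorProb : ∀ {m} → ProdDist m → DTree m → BoolFun m → ℚ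
errorProb {m} μ T g = sumℚ (map (λ x → probVec (proj₁ μ) x * differ (run T x) (g x)) (allInputs m))

IsMin : (ℕ → Set) → ℕ → Set
IsMin P n = P n × (∀ k → P k → n ℕ.≤ k)

IsMax : (ℕ → Set) → ℕ → Set
IsMax P n = P n × (∀ k → P k → k ℕ.≤ n)

IsDμ : ∀ {m} → ProdDist m → ℚ → BoolFun m → ℕ → Set
IsDμ {m} μ ε g = IsMin (λ d → ∃ λ (T : DTree m) → (depth T ≡ d) × (errorProb μ T g ≤ ε))

IsDprod : ∀ {m} → BoolFun m → ℕ → Set
IsDprod {m} g = IsMax (λ d → ∃ λ (μ : ProdDist m) → IsDμ μ oneThird g d)

-- Randomized decision trees: finitely supported distributions over
-- deterministic trees, given as a list of (positive weight, tree)
-- with weights summing to 1.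

RTree : ℕ → Set
RTree m = List (ℚ × DTree m)

IsDistribution : ∀ {m} → RTree m → Set
IsDistribution R = All (λ wt → 0ℚ < proj₁ wt) R × (sumℚ (map proj₁ R) ≡ 1ℚ)

queryComplexity : ∀ {m} → RTree m → ℕ
queryComplexity = foldr (λ wt q → depth (proj₂ wt) ⊔ q) 0

Finds : ∀ {m} → DTree m → Input m → Input m → Set
Finds T x y = Any (λ i → lookup x i ≢ lookup y i) (queried T x)

-- Pr_{T∼R}[T run on x queries some index where x and y differ]
-- (defined as the total weight of such trees; a decidable predicate is
-- not needed since we quantify over a sub-list)
data SubWeight {m : ℕ} (x y : Input m) : RTree m → ℚ → Set where
  []   : SubWeight x y [] 0ℚ
  keep : ∀ {w T R s} → Finds T x y → SubWeight x y R s → SubWeight x y ((w , T) ∷ R) (w + s)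
  skip : ∀ {w T R s} → ¬ Finds T x y → SubWeight x y R s → SubWeight x y ((w , T) ∷ R) s

IsSabotage : ∀ {m} → ℚ → BoolFun m → RTree m → Set
IsSabotage {m} ε g R =
  ∀ (x y : Input m) → g x ≡ false → g y ≡ true →
    ∀ s → SubWeight x y R s → (1ℚ - ε) ≤ s

IsRS : ∀ {m} → BoolFun m → ℕ → Set
IsRS {m} g = IsMin (λ r → ∃ λ (R : RTree m) →
  IsDistribution R × IsSabotage oneThird g R × (queryComplexity R ≡ r))

{-# OPTIONS --safe #-}

-- Let R be a sabotage tree of complexity r and μ a product distribution.  Compose k = O(log r)
-- trees drawn from R into one tree T, and let (x , y) be a pair in which y arises from x ∼ μ by
-- resampling each coordinate with probability 2⁻ˢ, where 2ˢ is about k r.  If g x ≠ g y, then T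
-- fails to separate x from y with probability at most 3⁻ᵏ.  With constant probability the noise
-- leaves all of the at most k r coordinates queried by T untouched, so inside an average leaf of T the noise
-- changes g with probability O(3⁻ᵏ).  Conditioned on a leaf, μ is again a product distribution,
-- and a full resampling splits into 2ˢ steps of rate 2⁻ˢ; hence two independent inputs from the
-- same leaf disagree under g with probability O(2ˢ 3⁻ᵏ) ≤ 1/3, and this bounds the error of
-- labelling the leaves of T by majority.
module Submission where

open import Defs
open import Data.Bool using (Bool; true; false; if_then_else_)
open import Data.Bool.Properties using () renaming (_≟_ to _≟ᵇ_)
open import Data.Fin using (zero; suc)
import Data.Integer as ℤ
open import Data.List using ([]; _∷_; _++_)
import Data.List as List
import Data.List.Properties as List
open import Data.List.Relation.Unary.All using (All; []; _∷_)
open import Data.List.Relation.Unary.Any using (here; there; any?)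
open import Data.Nat using (ℕ; _≤_; _*_; _^_; _+_; zero; suc; s≤s)
import Data.Nat as ℕ
import Data.Nat.Properties as ℕ
open import Data.Nat.Logarithm using (⌊log₂_⌋; ⌊log₂⌋-mono-≤; ⌊log₂[2^n]⌋≡n)
open import Data.Product using (∃₂; ∃; _×_; _,_; proj₁; proj₂; swap)
open import Data.Rational using (ℚ; 0ℚ; 1ℚ; ½; nonNegative; positive) renaming (_+_ to _⊕_; _-_ to _⊖_; _*_ to _⊛_; _≤_ to _≼_)
import Data.Rational as ℚ
import Data.Rational.Properties as ℚ
open import Data.Rational.Solver using (module +-*-Solver)
open import Data.Sum using (_⊎_; inj₁; inj₂)
open import Data.Vec using (Vec; []; _∷_; lookup; map; _[_]≔_; toList)
import Data.Vec.Properties as Vec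
open import Relation.Binary.PropositionalEquality using (_≡_; _≢_; refl; sym; trans; cong; cong₂; subst; subst₂; module ≡-Reasoning)
open import Relation.Nullary using (Dec; yes; no; ¬?; contradiction; toWitness)
open +-*-Solver using (solve; _:=_; _:+_; _:*_; _:-_; con)

-- Order arithmetic on the rationals.

*-monoˡ : ∀ {r p q} → 0ℚ ≼ r → p ≼ q → r ⊛ p ≼ r ⊛ q
*-monoˡ {r} 0≤r = ℚ.*-monoˡ-≤-nonNeg r {{nonNegative 0≤r}}

*-monoʳ : ∀ {r p q} → 0ℚ ≼ r → p ≼ q → p ⊛ r ≼ q ⊛ r
*-monoʳ {r} 0≤r = ℚ.*-monoʳ-≤-nonNeg r {{nonNegative 0≤r}}

0≤* : ∀ {p q} → 0ℚ ≼ p → 0ℚ ≼ q → 0ℚ ≼ p ⊛ q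
0≤* {p} {q} 0≤p 0≤q = subst (_≼ p ⊛ q) (ℚ.*-zeroʳ p) (*-monoˡ 0≤p 0≤q)

0≤+ : ∀ {p q} → 0ℚ ≼ p → 0ℚ ≼ q → 0ℚ ≼ p ⊕ q
0≤+ = ℚ.+-mono-≤

≤⇒0≤- : ∀ {p q} → p ≼ q → 0ℚ ≼ q ⊖ p
≤⇒0≤- {p} {q} p≤q = subst (_≼ q ⊖ p) (ℚ.+-inverseʳ p) (ℚ.+-monoˡ-≤ (ℚ.- p) p≤q)

0≤-⇒≤ : ∀ {p q} → 0ℚ ≼ q ⊖ p → p ≼ q
0≤-⇒≤ {p} {q} h = subst₂ _≼_ (ℚ.+-identityˡ p) (solve 2 (λ p q → q :- p :+ p := q) refl p q) (ℚ.+-monoˡ-≤ p h)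

0≤½ : 0ℚ ≼ ½
0≤½ = ℚ.nonNegative⁻¹ ½

0≤1 : 0ℚ ≼ 1ℚ
0≤1 = ℚ.nonNegative⁻¹ 1ℚ

-- Probabilities and expectation functionals.

record Unit : Set where
  constructor unit
  field
    val : ℚ
    0≤val : 0ℚ ≼ val
    val≤1 : val ≼ 1ℚ

open Unit

mixℚ : ℚ → ℚ → ℚ → ℚ
mixℚ q x y = (1ℚ ⊖ q) ⊛ x ⊕ q ⊛ y

mixℚ-mono : ∀ (q : Unit) {x x′ y y′} → x ≼ x′ → y ≼ y′ → mixℚ (val q) x y ≼ mixℚ (val q) x′ y′
mixℚ-mono q h h′ = ℚ.+-mono-≤ (*-monoˡ (≤⇒0≤- (val≤1 q)) h) (*-monoˡ (0≤val q) h′)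

0u 1u : Unit
0u = unit 0ℚ ℚ.≤-refl 0≤1
1u = unit 1ℚ 0≤1 ℚ.≤-refl

halve : Unit → Unit
halve q = unit (val q ⊛ ½) (0≤* (0≤val q) 0≤½)
  (ℚ.≤-trans (*-monoʳ 0≤½ (val≤1 q)) (subst (ℚ._≤ 1ℚ) (sym (ℚ.*-identityˡ ½)) (0≤-⇒≤ 0≤½)))

bit : Bool → Unit
bit false = 0u
bit true = 1u

-- A probability measure, represented by its expectation functional.
record Mean (A : Set) : Set where
  field
    𝔼 : (A → ℚ) → ℚ
    mono : ∀ {f f′} → (∀ a → f a ≼ f′ a) → 𝔼 f ≼ 𝔼 f′
    add : ∀ f f′ → 𝔼 (λ a → f a ⊕ f′ a) ≡ 𝔼 f ⊕ 𝔼 f′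
    scale : ∀ c f → 𝔼 (λ a → c ⊛ f a) ≡ c ⊛ 𝔼 f
    const : ∀ c → 𝔼 (λ _ → c) ≡ c

  ext : ∀ {f f′} → (∀ a → f a ≡ f′ a) → 𝔼 f ≡ 𝔼 f′
  ext h = ℚ.≤-antisym (mono λ a → ℚ.≤-reflexive (h a)) (mono λ a → ℚ.≤-reflexive (sym (h a)))

  scaleʳ : ∀ c f → 𝔼 (λ a → f a ⊛ c) ≡ 𝔼 f ⊛ c
  scaleʳ c f = trans (ext λ a → ℚ.*-comm (f a) c) (trans (scale c f) (ℚ.*-comm c (𝔼 f)))

  𝔼-mixℚ : ∀ q f f′ → 𝔼 (λ a → mixℚ q (f a) (f′ a)) ≡ mixℚ q (𝔼 f) (𝔼 f′)
  𝔼-mixℚ q f f′ = trans (add _ _) (cong₂ _⊕_ (scale (1ℚ ⊖ q) f) (scale q f′))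

  nonneg : ∀ {f} → (∀ a → 0ℚ ≼ f a) → 0ℚ ≼ 𝔼 f
  nonneg {f} h = subst (_≼ 𝔼 f) (const 0ℚ) (mono h)

open Mean

point : ∀ {A} → A → Mean A
point a = record
  { 𝔼 = λ f → f a ; mono = λ h → h a ; add = λ _ _ → refl ; scale = λ _ _ → refl ; const = λ _ → refl }

mix : ∀ {A} → Unit → Mean A → Mean A → Mean A
mix {A} q X Y = record
  { 𝔼 = λ f → mixℚ (val q) (𝔼 X f) (𝔼 Y f)
  ; mono = λ h → mixℚ-mono q (mono X h) (mono Y h)
  ; add = λ f f′ → trans (cong₂ (mixℚ (val q)) (add X f f′) (add Y f f′))
      (solve 5 (λ q x x′ y y′ → (con 1ℚ :- q) :* (x :+ x′) :+ q :* (y :+ y′)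
        := ((con 1ℚ :- q) :* x :+ q :* y) :+ ((con 1ℚ :- q) :* x′ :+ q :* y′)) refl (val q) (𝔼 X f) (𝔼 X f′) (𝔼 Y f) (𝔼 Y f′))
  ; scale = λ c f → trans (cong₂ (mixℚ (val q)) (scale X c f) (scale Y c f))
      (solve 4 (λ q c x y → (con 1ℚ :- q) :* (c :* x) :+ q :* (c :* y)
        := c :* ((con 1ℚ :- q) :* x :+ q :* y)) refl (val q) c (𝔼 X f) (𝔼 Y f))
  ; const = λ c → trans (cong₂ (mixℚ (val q)) (const X c) (const Y c))
      (solve 2 (λ q c → (con 1ℚ :- q) :* c :+ q :* c := c) refl (val q) c)
  }

bind : ∀ {A B} → Mean A → (A → Mean B) → Mean B
bind X k = record
  { 𝔼 = λ f → 𝔼 X λ a → 𝔼 (k a) f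
  ; mono = λ h → mono X λ a → mono (k a) h
  ; add = λ f f′ → trans (ext X λ a → add (k a) f f′) (add X _ _)
  ; scale = λ c f → trans (ext X λ a → scale (k a) c f) (scale X c _)
  ; const = λ c → trans (ext X λ a → const (k a) c) (const X c)
  }

push : ∀ {A B} → (A → B) → Mean A → Mean B
push h X = bind X λ a → point (h a)

bernoulli : Unit → Mean Bool
bernoulli p = mix p (point false) (point true)

-- Product measures.

product : ∀ {P A : Set} {m} → (P → Mean A) → Vec P m → Mean (Vec A m)
product C [] = point []
product C (p ∷ ps) = bind (C p) λ a → push (a ∷_) (product C ps)

product-push : ∀ {P A B : Set} (C : P → Mean A) (C′ : P → Mean B) (h : A → B) →
  (∀ p f → 𝔼 (C p) (λ a → f (h a)) ≡ 𝔼 (C′ p) f) →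
  ∀ {m} (ps : Vec P m) φ → 𝔼 (product C ps) (λ v → φ (map h v)) ≡ 𝔼 (product C′ ps) φ
product-push C C′ h eq [] φ = refl
product-push C C′ h eq (p ∷ ps) φ =
  trans (ext (C p) λ a → product-push C C′ h eq ps λ v → φ (h a ∷ v)) (eq p _)

-- The hypothesis on `C p` says, through expectations, that `C p` is a point mass at `a`. This lets
-- a query of a fixed coordinate be evaluated under the expectation.
product-support : ∀ {P A : Set} (C : P → Mean A) p a →
  (∀ {f f′} → f a ≡ f′ a → 𝔼 (C p) f ≡ 𝔼 (C p) f′) →
  ∀ {m} (ps : Vec P m) i {φ φ′} → (∀ v → lookup v i ≡ a → φ v ≡ φ′ v) →
  𝔼 (product C (ps [ i ]≔ p)) φ ≡ 𝔼 (product C (ps [ i ]≔ p)) φ′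
product-support C p a supp (_ ∷ ps) zero h = supp (ext (product C ps) λ v → h (a ∷ v) refl)
product-support C p a supp (p′ ∷ ps) (suc i) h =
  ext (C p′) λ a′ → product-support C p a supp ps i λ v → h (a′ ∷ v)

-- Conditioning on coordinate `i` only replaces its bias by `0u` or `1u`, so subcubes again carry
-- product measures.
product-split : ∀ {A : Set} (C : Unit → Mean A) →
  (∀ p f → 𝔼 (C p) f ≡ mixℚ (val p) (𝔼 (C 0u) f) (𝔼 (C 1u) f)) →
  ∀ {m} (ps : Vec Unit m) i φ → 𝔼 (product C ps) φ ≡
    mixℚ (val (lookup ps i)) (𝔼 (product C (ps [ i ]≔ 0u)) φ) (𝔼 (product C (ps [ i ]≔ 1u)) φ)
product-split C eq (p ∷ ps) zero φ = eq p _
product-split C eq (p ∷ ps) (suc i) φ =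
  trans (ext (C p) λ a → product-split C eq ps i λ v → φ (a ∷ v)) (𝔼-mixℚ (C p) (val (lookup ps i)) _ _)

-- The version with a loss: in its use `c` is the probability that the noise leaves coordinate `i`
-- alone.
product-split-≤ : ∀ {A : Set} (C : Unit → Mean A) c →
  (∀ p f → (∀ a → 0ℚ ≼ f a) → c ⊛ mixℚ (val p) (𝔼 (C 0u) f) (𝔼 (C 1u) f) ≼ 𝔼 (C p) f) →
  ∀ {m} (ps : Vec Unit m) i φ → (∀ v → 0ℚ ≼ φ v) →
  c ⊛ mixℚ (val (lookup ps i)) (𝔼 (product C (ps [ i ]≔ 0u)) φ) (𝔼 (product C (ps [ i ]≔ 1u)) φ)
    ≼ 𝔼 (product C ps) φ
product-split-≤ C c le (p ∷ ps) zero φ 0≤φ = le p _ λ a → nonneg (product C ps) λ v → 0≤φ (a ∷ v)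
product-split-≤ C c le (p ∷ ps) (suc i) φ 0≤φ = ℚ.≤-trans
  (ℚ.≤-reflexive (sym (trans (scale (C p) c _) (cong (c ⊛_) (𝔼-mixℚ (C p) (val (lookup ps i)) _ _)))))
  (mono (C p) λ a → product-split-≤ C c le ps i _ λ v → 0≤φ (a ∷ v))

-- Noise on bits and inputs, and the halving of its rate.

diagonal : Mean Bool → Mean (Bool × Bool)
diagonal X = push (λ a → a , a) X

independent : Mean Bool → Mean (Bool × Bool)
independent X = bind X λ a → push (a ,_) X

noisy : Unit → Unit → Mean (Bool × Bool)
noisy q p = mix q (diagonal (bernoulli p)) (independent (bernoulli p))

left right : ∀ {m} → Vec (Bool × Bool) m → Input m
left = map proj₁
right = map proj₂

Chain : Set
Chain = Bool × Bool × Bool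

-- Spreads the resampling of rate q over two steps: a resampled bit changes in either with probability ½.
chain : Unit → Unit → Mean Chain
chain q p = mix q (push (λ a → a , a , a) X)
  (mix (halve 1u) (bind X λ a → push (λ b → a , b , b) X) (bind X λ a → push (λ b → a , a , b) X))
  where X = bernoulli p

outer first second : Chain → Bool × Bool
outer (a , b , c) = a , c
first (a , b , c) = a , b
second (a , b , c) = b , c

-- In both inner branches the outer bits are two independent draws, so the inner mixture collapses.
chain-outer : ∀ q p f → 𝔼 (chain q p) (λ t → f (outer t)) ≡ 𝔼 (noisy q p) f
chain-outer q p f = cong (mixℚ (val q) (𝔼 (diagonal (bernoulli p)) f))
  (solve 1 (λ x → (con 1ℚ :- con ½) :* x :+ con ½ :* x := x) refl (𝔼 (independent (bernoulli p)) f))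

chain-first : ∀ q p f → 𝔼 (chain q p) (λ t → f (first t)) ≡ 𝔼 (noisy (halve q) p) f
chain-first q p f = trans
  (cong (λ z → mixℚ (val q) D (mixℚ ½ I z)) (ext X λ a → const X (f (a , a))))
  (solve 3 (λ q d i → (con 1ℚ :- q) :* d :+ q :* ((con 1ℚ :- con ½) :* i :+ con ½ :* d)
    := (con 1ℚ :- q :* con ½) :* d :+ (q :* con ½) :* i) refl (val q) D I)
  where
    X = bernoulli p
    D = 𝔼 (diagonal X) f
    I = 𝔼 (independent X) f

chain-second : ∀ q p f → 𝔼 (chain q p) (λ t → f (second t)) ≡ 𝔼 (noisy (halve q) p) f
chain-second q p f = trans
  (cong (λ z → mixℚ (val q) D (mixℚ ½ z I)) (const X D))
  (solve 3 (λ q d i → (con 1ℚ :- q) :* d :+ q :* ((con 1ℚ :- con ½) :* d :+ con ½ :* i)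
    := (con 1ℚ :- q :* con ½) :* d :+ (q :* con ½) :* i) refl (val q) D I)
  where
    X = bernoulli p
    D = 𝔼 (diagonal X) f
    I = 𝔼 (independent X) f

-- A pair of inputs is encoded as a vector of pairs of bits: its law is then again a product, and
-- facts about noise reduce to one coordinate.
noise : ∀ {m} → Unit → Vec Unit m → Mean (Vec (Bool × Bool) m)
noise q = product (noisy q)

disagree : ∀ {m} → BoolFun m → Vec (Bool × Bool) m → ℚ
disagree g v = differ (g (left v)) (g (right v))

0≤differ : ∀ a b → 0ℚ ≼ differ a b
0≤differ false false = ℚ.≤-refl
0≤differ false true = 0≤1
0≤differ true false = 0≤1
0≤differ true true = ℚ.≤-refl

differ≤1 : ∀ a b → differ a b ≼ 1ℚ
differ≤1 false false = 0≤1
differ≤1 false true = ℚ.≤-refl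
differ≤1 true false = ℚ.≤-refl
differ≤1 true true = 0≤1

differ-triangle : ∀ a b c → differ a c ≼ differ a b ⊕ differ b c
differ-triangle false false c = ℚ.≤-reflexive (sym (ℚ.+-identityˡ (differ false c)))
differ-triangle true true c = ℚ.≤-reflexive (sym (ℚ.+-identityˡ (differ true c)))
differ-triangle false true false = 0≤+ 0≤1 0≤1
differ-triangle false true true = ℚ.≤-refl
differ-triangle true false false = ℚ.≤-refl
differ-triangle true false true = 0≤+ 0≤1 0≤1

2ℚ : ℚ
2ℚ = 1ℚ ⊕ 1ℚ

-- If the ends of a chain disagree under `g`, then so do the ends of one of its two steps, and
-- either step is noise of rate `halve q`.
disagree-halve : ∀ {m} (g : BoolFun m) q ps → 𝔼 (noise q ps) (disagree g) ≼ 2ℚ ⊛ 𝔼 (noise (halve q) ps) (disagree g)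
disagree-halve g q ps = begin
  𝔼 (noise q ps) (disagree g)                                      ≡⟨ product-push (chain q) (noisy q) outer (chain-outer q) ps (disagree g) ⟨
  𝔼 M (λ v → disagree g (map outer v))                             ≤⟨ mono M triangle ⟩
  𝔼 M (λ v → disagree g (map first v) ⊕ disagree g (map second v)) ≡⟨ add M _ _ ⟩
  𝔼 M (λ v → disagree g (map first v)) ⊕ 𝔼 M (λ v → disagree g (map second v))
    ≡⟨ cong₂ _⊕_ (product-push (chain q) (noisy (halve q)) first (chain-first q) ps (disagree g))
                 (product-push (chain q) (noisy (halve q)) second (chain-second q) ps (disagree g)) ⟩
  N ⊕ N ≡⟨ solve 1 (λ n → n :+ n := con 2ℚ :* n) refl N ⟩
  2ℚ ⊛ N ∎
  where
    open ℚ.≤-Reasoning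
    M = product (chain q) ps
    N = 𝔼 (noise (halve q) ps) (disagree g)
    map-map : ∀ {A B C D : Set} {k} (f : B → D) (f′ : A → B) (h : C → D) (h′ : A → C) →
      (∀ a → f (f′ a) ≡ h (h′ a)) → (v : Vec A k) → map f (map f′ v) ≡ map h (map h′ v)
    map-map f f′ h h′ eq v = trans (sym (Vec.map-∘ f f′ v)) (trans (Vec.map-cong eq v) (Vec.map-∘ h h′ v))
    triangle : ∀ v → disagree g (map outer v) ≼ disagree g (map first v) ⊕ disagree g (map second v)
    triangle v
      rewrite map-map proj₁ outer proj₁ first (λ _ → refl) v
            | map-map proj₂ outer proj₂ second (λ _ → refl) v
            | map-map proj₂ first proj₁ second (λ _ → refl) v
      = differ-triangle (g (left (map first v))) (g (left (map second v))) (g (right (map second v)))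

pow : ℚ → ℕ → ℚ
pow a zero = 1ℚ
pow a (suc n) = a ⊛ pow a n

0≤pow : ∀ {a} n → 0ℚ ≼ a → 0ℚ ≼ pow a n
0≤pow zero 0≤a = 0≤1
0≤pow (suc n) 0≤a = 0≤* 0≤a (0≤pow n 0≤a)

pow≤1 : ∀ {a} n → 0ℚ ≼ a → a ≼ 1ℚ → pow a n ≼ 1ℚ
pow≤1 zero 0≤a a≤1 = ℚ.≤-refl
pow≤1 {a} (suc n) 0≤a a≤1 =
  ℚ.≤-trans (*-monoˡ 0≤a (pow≤1 n 0≤a a≤1)) (subst (_≼ 1ℚ) (sym (ℚ.*-identityʳ a)) a≤1)

0≤2 : 0ℚ ≼ 2ℚ
0≤2 = 0≤+ 0≤1 0≤1

rate : ℕ → Unit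
rate zero = 1u
rate (suc s) = halve (rate s)

disagree-rate : ∀ {m} (g : BoolFun m) s ps →
  𝔼 (noise 1u ps) (disagree g) ≼ pow 2ℚ s ⊛ 𝔼 (noise (rate s) ps) (disagree g)
disagree-rate g zero ps = ℚ.≤-reflexive (sym (ℚ.*-identityˡ _))
disagree-rate g (suc s) ps = begin
  𝔼 (noise 1u ps) (disagree g)                        ≤⟨ disagree-rate g s ps ⟩
  pow 2ℚ s ⊛ 𝔼 (noise (rate s) ps) (disagree g)       ≤⟨ *-monoˡ (0≤pow s 0≤2) (disagree-halve g (rate s) ps) ⟩
  pow 2ℚ s ⊛ (2ℚ ⊛ N)                                 ≡⟨ solve 3 (λ a b n → a :* (b :* n) := (b :* a) :* n) refl (pow 2ℚ s) 2ℚ N ⟩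
  pow 2ℚ (suc s) ⊛ N ∎
  where
    open ℚ.≤-Reasoning
    N = 𝔼 (noise (rate (suc s)) ps) (disagree g)

-- Conditioning on a single coordinate.

mixℚ-0 : ∀ x y → mixℚ 0ℚ x y ≡ x
mixℚ-0 = solve 2 (λ x y → (con 1ℚ :- con 0ℚ) :* x :+ con 0ℚ :* y := x) refl

mixℚ-1 : ∀ x y → mixℚ 1ℚ x y ≡ y
mixℚ-1 = solve 2 (λ x y → (con 1ℚ :- con 1ℚ) :* x :+ con 1ℚ :* y := y) refl

bernoulli-bit : ∀ b f → 𝔼 (bernoulli (bit b)) f ≡ f b
bernoulli-bit false f = mixℚ-0 (f false) (f true)
bernoulli-bit true f = mixℚ-1 (f false) (f true)

noisy-bit : ∀ q b f → 𝔼 (noisy q (bit b)) f ≡ f (b , b)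
noisy-bit q b f = trans
  (cong₂ (mixℚ (val q)) (bernoulli-bit b λ a → f (a , a))
    (trans (bernoulli-bit b λ a → 𝔼 (bernoulli (bit b)) λ a′ → f (a , a′)) (bernoulli-bit b λ a′ → f (b , a′))))
  (solve 2 (λ q c → (con 1ℚ :- q) :* c :+ q :* c := c) refl (val q) (f (b , b)))

-- With probability `1 - q` the bit is not resampled and the pair is a doubled draw of bias `p`; the
-- nonnegative resampled part is dropped.
noisy-split-≤ : ∀ q p f → (∀ a → 0ℚ ≼ f a) →
  (1ℚ ⊖ val q) ⊛ mixℚ (val p) (𝔼 (noisy q 0u) f) (𝔼 (noisy q 1u) f) ≼ 𝔼 (noisy q p) f
noisy-split-≤ q p f 0≤f = begin
  (1ℚ ⊖ val q) ⊛ mixℚ (val p) (𝔼 (noisy q 0u) f) (𝔼 (noisy q 1u) f)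
    ≡⟨ cong₂ (λ x y → (1ℚ ⊖ val q) ⊛ mixℚ (val p) x y) (noisy-bit q false f) (noisy-bit q true f) ⟩
  D       ≡⟨ ℚ.+-identityʳ D ⟨
  D ⊕ 0ℚ  ≤⟨ ℚ.+-monoʳ-≤ D (0≤* (0≤val q) (nonneg (independent (bernoulli p)) 0≤f)) ⟩
  𝔼 (noisy q p) f ∎
  where
    open ℚ.≤-Reasoning
    D = (1ℚ ⊖ val q) ⊛ 𝔼 (diagonal (bernoulli p)) f

bernoulli-split : ∀ p f → 𝔼 (bernoulli p) f ≡ mixℚ (val p) (𝔼 (bernoulli 0u) f) (𝔼 (bernoulli 1u) f)
bernoulli-split p f = sym (cong₂ (mixℚ (val p)) (bernoulli-bit false f) (bernoulli-bit true f))

-- Independent pairs and majority labels.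

noise-independent : ∀ {m} (ps : Vec Unit m) f f′ →
  𝔼 (noise 1u ps) (λ v → f (left v) ⊛ f′ (right v)) ≡ 𝔼 (product bernoulli ps) f ⊛ 𝔼 (product bernoulli ps) f′
noise-independent [] f f′ = refl
noise-independent (p ∷ ps) f f′ = trans (mixℚ-1 (𝔼 X λ a → G (a , a)) (𝔼 X λ a → 𝔼 X λ b → G (a , b))) (trans
  (ext X λ a → trans (ext X λ b → noise-independent ps (λ x → f (a ∷ x)) λ y → f′ (b ∷ y)) (scale X (F a) F′))
  (scaleʳ X (𝔼 X F′) F))
  where
    X = bernoulli p
    G : Bool × Bool → ℚ
    G (a , b) = 𝔼 (noise 1u ps) λ v → f (a ∷ left v) ⊛ f′ (b ∷ right v)
    F F′ : Bool → ℚ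
    F a = 𝔼 (product bernoulli ps) λ x → f (a ∷ x)
    F′ b = 𝔼 (product bernoulli ps) λ y → f′ (b ∷ y)

labelError : ∀ {m} → BoolFun m → Vec Unit m → Bool → ℚ
labelError g ps b = 𝔼 (product bernoulli ps) λ x → differ b (g x)

labelError-sum : ∀ {m} (g : BoolFun m) ps → labelError g ps true ⊕ labelError g ps false ≡ 1ℚ
labelError-sum g ps = trans (sym (add M _ _)) (trans (ext M λ x → cover (g x)) (const M 1ℚ))
  where
    M = product bernoulli ps
    cover : ∀ b → differ true b ⊕ differ false b ≡ 1ℚ
    cover false = refl
    cover true = refl

-- Two bits differ exactly when one refutes the label `true` and the other the label `false`, in
-- either order; for independent inputs these probabilities multiply.
disagree-independent : ∀ {m} (g : BoolFun m) ps → 𝔼 (noise 1u ps) (disagree g) ≡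
  labelError g ps true ⊛ labelError g ps false ⊕ labelError g ps false ⊛ labelError g ps true
disagree-independent g ps = trans (ext N λ v → split (g (left v)) (g (right v))) (trans (add N _ _)
  (cong₂ _⊕_ (noise-independent ps (λ x → differ true (g x)) (λ x → differ false (g x)))
             (noise-independent ps (λ x → differ false (g x)) (λ x → differ true (g x)))))
  where
    N = noise 1u ps
    split : ∀ a b → differ a b ≡ differ true a ⊛ differ false b ⊕ differ false a ⊛ differ true b
    split false false = refl
    split false true = refl
    split true false = refl
    split true true = refl

-- For complementary probabilities the minimum is at most `2 u v`. This trades the error of the
-- majority label for the disagreement of two independent samples.
min≤product : ∀ {u v} → 0ℚ ≼ u → u ≼ v → u ⊕ v ≡ 1ℚ → u ≼ u ⊛ v ⊕ v ⊛ u
min≤product {u} {v} 0≤u u≤v sum = begin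
  u                 ≡⟨ ℚ.*-identityʳ u ⟨
  u ⊛ 1ℚ            ≡⟨ cong (u ⊛_) sum ⟨
  u ⊛ (u ⊕ v)       ≡⟨ solve 2 (λ u v → u :* (u :+ v) := u :* v :+ u :* u) refl u v ⟩
  u ⊛ v ⊕ u ⊛ u     ≤⟨ ℚ.+-monoʳ-≤ (u ⊛ v) (*-monoʳ 0≤u u≤v) ⟩
  u ⊛ v ⊕ v ⊛ u ∎
  where open ℚ.≤-Reasoning

best-label : ∀ {m} (g : BoolFun m) ps → ∃ λ b → labelError g ps b ≼ 𝔼 (noise 1u ps) (disagree g)
best-label g ps = choose (ℚ.≤-total u v)
  where
    u = labelError g ps true
    v = labelError g ps false
    0≤error : ∀ b → 0ℚ ≼ labelError g ps b
    0≤error b = nonneg (product bernoulli ps) λ x → 0≤differ b (g x)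
    choose : u ≼ v ⊎ v ≼ u → ∃ λ b → labelError g ps b ≼ 𝔼 (noise 1u ps) (disagree g)
    choose (inj₁ u≤v) = true , subst (u ≼_) (sym (disagree-independent g ps))
      (min≤product (0≤error true) u≤v (labelError-sum g ps))
    choose (inj₂ v≤u) = false , subst (v ≼_) (sym (trans (disagree-independent g ps) (ℚ.+-comm (u ⊛ v) (v ⊛ u))))
      (min≤product (0≤error false) v≤u (trans (ℚ.+-comm v u) (labelError-sum g ps)))

-- Error of a relabelled tree against confused pairs.

-- `ps` holds the biases conditioned on the answers so far, so each leaf gets the better label for
-- its own subcube. A repeated query is harmless: its impossible branch has weight zero in
-- `error-node`.
relabel : ∀ {m} → BoolFun m → DTree m → Vec Unit m → DTree m
relabel g (leaf _) ps = leaf (proj₁ (best-label g ps))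
relabel g (node i t₀ t₁) ps = node i (relabel g t₀ (ps [ i ]≔ 0u)) (relabel g t₁ (ps [ i ]≔ 1u))

depth-relabel : ∀ {m} (g : BoolFun m) T ps → depth (relabel g T ps) ≡ depth T
depth-relabel g (leaf _) ps = refl
depth-relabel g (node i t₀ t₁) ps = cong suc (cong₂ ℕ._⊔_ (depth-relabel g t₀ _) (depth-relabel g t₁ _))

error : ∀ {m} → BoolFun m → DTree m → Vec Unit m → ℚ
error g T ps = 𝔼 (product bernoulli ps) λ x → differ (run T x) (g x)

ifAgree : Bool × Bool → ℚ → ℚ → ℚ
ifAgree (false , false) x y = x
ifAgree (true , true) x y = y
ifAgree _ x y = 0ℚ

-- The indicator that the run on left v queries no coordinate where left v and right v differ.
unseparated : ∀ {m} → DTree m → Vec (Bool × Bool) m → ℚ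
unseparated (leaf _) v = 1ℚ
unseparated (node i t₀ t₁) v = ifAgree (lookup v i) (unseparated t₀ v) (unseparated t₁ v)

0≤ifAgree : ∀ c {x y} → 0ℚ ≼ x → 0ℚ ≼ y → 0ℚ ≼ ifAgree c x y
0≤ifAgree (false , false) 0≤x 0≤y = 0≤x
0≤ifAgree (true , true) 0≤x 0≤y = 0≤y
0≤ifAgree (false , true) 0≤x 0≤y = ℚ.≤-refl
0≤ifAgree (true , false) 0≤x 0≤y = ℚ.≤-refl

0≤unseparated : ∀ {m} (T : DTree m) v → 0ℚ ≼ unseparated T v
0≤unseparated (leaf _) v = 0≤1
0≤unseparated (node i t₀ t₁) v = 0≤ifAgree (lookup v i) (0≤unseparated t₀ v) (0≤unseparated t₁ v)

-- The indicator that `T` fails on a pair that a sabotage tree ought to separate; composition with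
-- trees of `R` drives its expectation down.
confused : ∀ {m} → BoolFun m → DTree m → Vec (Bool × Bool) m → ℚ
confused g T v = disagree g v ⊛ unseparated T v

0≤confused : ∀ {m} (g : BoolFun m) T v → 0ℚ ≼ confused g T v
0≤confused g T v = 0≤* (0≤differ (g (left v)) (g (right v))) (0≤unseparated T v)

error-node : ∀ {m} (g : BoolFun m) i t₀ t₁ ps → error g (node i t₀ t₁) ps ≡
  mixℚ (val (lookup ps i)) (error g t₀ (ps [ i ]≔ 0u)) (error g t₁ (ps [ i ]≔ 1u))
error-node g i t₀ t₁ ps = trans (product-split bernoulli bernoulli-split ps i _)
  (cong₂ (mixℚ (val (lookup ps i)))
    (product-support bernoulli 0u false (λ {f} {f′} → supp false f f′) ps i λ x x≡ → cong (λ b → differ (if b then run t₁ x else run t₀ x) (g x)) x≡)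
    (product-support bernoulli 1u true (λ {f} {f′} → supp true f f′) ps i λ x x≡ → cong (λ b → differ (if b then run t₁ x else run t₀ x) (g x)) x≡))
  where
    supp : ∀ b f f′ → f b ≡ f′ b → 𝔼 (bernoulli (bit b)) f ≡ 𝔼 (bernoulli (bit b)) f′
    supp b f f′ h = trans (bernoulli-bit b f) (trans h (sym (bernoulli-bit b f′)))

-- Only an inequality, unlike `error-node`: pairs whose coordinate `i` is resampled are given up, at
-- the price of the factor `1 - q`.
confused-node : ∀ {m} (g : BoolFun m) i t₀ t₁ q ps →
  (1ℚ ⊖ val q) ⊛ mixℚ (val (lookup ps i)) (𝔼 (noise q (ps [ i ]≔ 0u)) (confused g t₀)) (𝔼 (noise q (ps [ i ]≔ 1u)) (confused g t₁))
    ≼ 𝔼 (noise q ps) (confused g (node i t₀ t₁))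
confused-node g i t₀ t₁ q ps = subst (_≼ 𝔼 (noise q ps) (confused g (node i t₀ t₁)))
  (cong₂ (λ x y → (1ℚ ⊖ val q) ⊛ mixℚ (val (lookup ps i)) x y)
    (product-support (noisy q) 0u (false , false) (λ {f} {f′} → supp false f f′) ps i λ v v≡ → cong (λ c → disagree g v ⊛ ifAgree c (unseparated t₀ v) (unseparated t₁ v)) v≡)
    (product-support (noisy q) 1u (true , true) (λ {f} {f′} → supp true f f′) ps i λ v v≡ → cong (λ c → disagree g v ⊛ ifAgree c (unseparated t₀ v) (unseparated t₁ v)) v≡))
  (product-split-≤ (noisy q) (1ℚ ⊖ val q) (noisy-split-≤ q) ps i _ (0≤confused g (node i t₀ t₁)))
  where
    supp : ∀ b f f′ → f (b , b) ≡ f′ (b , b) → 𝔼 (noisy q (bit b)) f ≡ 𝔼 (noisy q (bit b)) f′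
    supp b f f′ h = trans (noisy-bit q b f) (trans h (sym (noisy-bit q b f′)))

-- On the subcube of a leaf the noise of rate 2⁻ˢ is the noise on the whole cube conditioned on
-- leaving the at most D queried coordinates alone, an event of probability at least (1 - 2⁻ˢ)ᴰ.
error-relabel : ∀ {m} (g : BoolFun m) s T D ps → depth T ≤ D →
  pow (1ℚ ⊖ val (rate s)) D ⊛ error g (relabel g T ps) ps ≼ pow 2ℚ s ⊛ 𝔼 (noise (rate s) ps) (confused g T)
error-relabel g s (leaf b) D ps _ = begin
  pow (1ℚ ⊖ q) D ⊛ e                       ≤⟨ *-monoʳ 0≤e (pow≤1 D (≤⇒0≤- (val≤1 (rate s))) 1-q≤1) ⟩
  1ℚ ⊛ e                                   ≡⟨ ℚ.*-identityˡ e ⟩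
  e                                        ≤⟨ proj₂ (best-label g ps) ⟩
  𝔼 (noise 1u ps) (disagree g)             ≤⟨ disagree-rate g s ps ⟩
  pow 2ℚ s ⊛ 𝔼 (noise (rate s) ps) (disagree g)
    ≡⟨ cong (pow 2ℚ s ⊛_) (ext (noise (rate s) ps) λ v → sym (ℚ.*-identityʳ (disagree g v))) ⟩
  pow 2ℚ s ⊛ 𝔼 (noise (rate s) ps) (confused g (leaf b)) ∎
  where
    open ℚ.≤-Reasoning
    q = val (rate s)
    b* = proj₁ (best-label g ps)
    e = labelError g ps b*
    0≤e : 0ℚ ≼ e
    0≤e = nonneg (product bernoulli ps) λ x → 0≤differ b* (g x)
    1-q≤1 : 1ℚ ⊖ q ≼ 1ℚ
    1-q≤1 = 0≤-⇒≤ (subst (0ℚ ≼_) (solve 1 (λ q → q := con 1ℚ :- (con 1ℚ :- q)) refl q) (0≤val (rate s)))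
error-relabel g s (node i t₀ t₁) (suc D) ps (s≤s h) = begin
  (1ℚ ⊖ q) ⊛ P ⊛ error g (relabel g (node i t₀ t₁) ps) ps
    ≡⟨ cong ((1ℚ ⊖ q) ⊛ P ⊛_) (error-node g i (relabel g t₀ ps₀) (relabel g t₁ ps₁) ps) ⟩
  (1ℚ ⊖ q) ⊛ P ⊛ mixℚ p e₀ e₁
    ≡⟨ solve 5 (λ r a p x y → r :* a :* ((con 1ℚ :- p) :* x :+ p :* y)
         := r :* ((con 1ℚ :- p) :* (a :* x) :+ p :* (a :* y))) refl (1ℚ ⊖ q) P p e₀ e₁ ⟩
  (1ℚ ⊖ q) ⊛ mixℚ p (P ⊛ e₀) (P ⊛ e₁)
    ≤⟨ *-monoˡ (≤⇒0≤- (val≤1 (rate s))) (mixℚ-mono (lookup ps i)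
         (error-relabel g s t₀ D ps₀ (ℕ.m⊔n≤o⇒m≤o (depth t₀) (depth t₁) h))
         (error-relabel g s t₁ D ps₁ (ℕ.m⊔n≤o⇒n≤o (depth t₀) (depth t₁) h))) ⟩
  (1ℚ ⊖ q) ⊛ mixℚ p (W ⊛ n₀) (W ⊛ n₁)
    ≡⟨ solve 5 (λ r a p x y → r :* ((con 1ℚ :- p) :* (a :* x) :+ p :* (a :* y))
         := a :* (r :* ((con 1ℚ :- p) :* x :+ p :* y))) refl (1ℚ ⊖ q) W p n₀ n₁ ⟩
  W ⊛ ((1ℚ ⊖ q) ⊛ mixℚ p n₀ n₁)
    ≤⟨ *-monoˡ (0≤pow s 0≤2) (confused-node g i t₀ t₁ (rate s) ps) ⟩
  W ⊛ 𝔼 (noise (rate s) ps) (confused g (node i t₀ t₁)) ∎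
  where
    open ℚ.≤-Reasoning
    q = val (rate s)
    p = val (lookup ps i)
    P = pow (1ℚ ⊖ q) D
    W = pow 2ℚ s
    ps₀ = ps [ i ]≔ 0u
    ps₁ = ps [ i ]≔ 1u
    e₀ = error g (relabel g t₀ ps₀) ps₀
    e₁ = error g (relabel g t₁ ps₁) ps₁
    n₀ = 𝔼 (noise (rate s) ps₀) (confused g t₀)
    n₁ = 𝔼 (noise (rate s) ps₁) (confused g t₁)

-- Composition of trees and separation of pairs.

infixr 5 _▷_

-- The labels of `T` are overwritten: the composed tree serves through its queries, and `relabel`
-- supplies labels afterwards.
_▷_ : ∀ {m} → DTree m → DTree m → DTree m
leaf _ ▷ T′ = T′
node i t₀ t₁ ▷ T′ = node i (t₀ ▷ T′) (t₁ ▷ T′)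

depth-▷ : ∀ {m} (T T′ : DTree m) → depth (T ▷ T′) ≤ depth T + depth T′
depth-▷ (leaf _) T′ = ℕ.≤-refl
depth-▷ (node i t₀ t₁) T′ = s≤s (ℕ.⊔-lub
  (ℕ.≤-trans (depth-▷ t₀ T′) (ℕ.+-monoˡ-≤ (depth T′) (ℕ.m≤m⊔n (depth t₀) (depth t₁))))
  (ℕ.≤-trans (depth-▷ t₁ T′) (ℕ.+-monoˡ-≤ (depth T′) (ℕ.m≤n⊔m (depth t₀) (depth t₁)))))

-- The same `T′` hangs below every leaf, so the composed run makes the queries of both runs and the
-- indicators multiply.
unseparated-▷ : ∀ {m} (T T′ : DTree m) v → unseparated (T ▷ T′) v ≡ unseparated T v ⊛ unseparated T′ v
unseparated-▷ (leaf _) T′ v = sym (ℚ.*-identityˡ (unseparated T′ v))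
unseparated-▷ (node i t₀ t₁) T′ v = trans
  (cong₂ (ifAgree (lookup v i)) (unseparated-▷ t₀ T′ v) (unseparated-▷ t₁ T′ v))
  (factor (lookup v i) (unseparated t₀ v) (unseparated t₁ v) (unseparated T′ v))
  where
    factor : ∀ c x y z → ifAgree c (x ⊛ z) (y ⊛ z) ≡ ifAgree c x y ⊛ z
    factor (false , false) x y z = refl
    factor (true , true) x y z = refl
    factor (false , true) x y z = sym (ℚ.*-zeroˡ z)
    factor (true , false) x y z = sym (ℚ.*-zeroˡ z)

confused-▷ : ∀ {m} (g : BoolFun m) T T′ v → confused g (T ▷ T′) v ≡ confused g T v ⊛ unseparated T′ v
confused-▷ g T T′ v = trans (cong (disagree g v ⊛_) (unseparated-▷ T T′ v)) (sym (ℚ.*-assoc (disagree g v) _ _))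

unseparated≤1 : ∀ {m} (T : DTree m) v → unseparated T v ≼ 1ℚ
unseparated≤1 (leaf _) v = ℚ.≤-refl
unseparated≤1 (node i t₀ t₁) v with lookup v i
... | false , false = unseparated≤1 t₀ v
... | true , true = unseparated≤1 t₁ v
... | false , true = 0≤1
... | true , false = 0≤1

Finds⇒unseparated≡0 : ∀ {m} (T : DTree m) v → Finds T (left v) (right v) → unseparated T v ≡ 0ℚ
Finds⇒unseparated≡0 (node i t₀ t₁) v (here x≢y) =
  disagreeing (lookup v i) (subst₂ _≢_ (Vec.lookup-map i proj₁ v) (Vec.lookup-map i proj₂ v) x≢y)
  where
    disagreeing : ∀ c → proj₁ c ≢ proj₂ c → ifAgree c (unseparated t₀ v) (unseparated t₁ v) ≡ 0ℚ
    disagreeing (false , false) ≢ = contradiction refl ≢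
    disagreeing (true , true) ≢ = contradiction refl ≢
    disagreeing (false , true) ≢ = refl
    disagreeing (true , false) ≢ = refl
Finds⇒unseparated≡0 (node i t₀ t₁) v (there found) rewrite Vec.lookup-map i proj₁ v with lookup v i
... | false , false = Finds⇒unseparated≡0 t₀ v found
... | true , true = Finds⇒unseparated≡0 t₁ v found
... | false , true = refl
... | true , false = refl

finds? : ∀ {m} (T : DTree m) x y → Dec (Finds T x y)
finds? T x y = any? (λ i → ¬? (lookup x i ≟ᵇ lookup y i)) (queried T x)

-- While a pair is unseparated, both inputs follow the same path. This carries the sabotage
-- guarantee, which runs trees on zeros of `g`, over to pairs whose left input is a one.
unseparated-swap : ∀ {m} (T : DTree m) v → unseparated T (map swap v) ≡ unseparated T v
unseparated-swap (leaf _) v = refl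
unseparated-swap (node i t₀ t₁) v
  rewrite Vec.lookup-map i swap v | unseparated-swap t₀ v | unseparated-swap t₁ v with lookup v i
... | false , false = refl
... | true , true = refl
... | false , true = refl
... | true , false = refl

-- Averaging over the sabotage distribution.

weights : ∀ {m} → RTree m → ℚ
weights R = sumℚ (List.map proj₁ R)

-- Inductions on the list meet tails whose weights do not sum to 1, so this is not packaged as a
-- `Mean`.
weightedSum : ∀ {m} → RTree m → (DTree m → ℚ) → ℚ
weightedSum [] F = 0ℚ
weightedSum ((w , T) ∷ R) F = w ⊛ F T ⊕ weightedSum R F

weightedSum-cong : ∀ {m} (R : RTree m) {F F′} → (∀ T → F T ≡ F′ T) → weightedSum R F ≡ weightedSum R F′
weightedSum-cong [] h = refl
weightedSum-cong ((w , T) ∷ R) h = cong₂ (λ x y → w ⊛ x ⊕ y) (h T) (weightedSum-cong R h)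

weightedSum-scale : ∀ {m} (R : RTree m) c F → weightedSum R (λ T → c ⊛ F T) ≡ c ⊛ weightedSum R F
weightedSum-scale [] c F = sym (ℚ.*-zeroʳ c)
weightedSum-scale ((w , T) ∷ R) c F = trans (cong (w ⊛ (c ⊛ F T) ⊕_) (weightedSum-scale R c F))
  (solve 4 (λ w c x y → w :* (c :* x) :+ c :* y := c :* (w :* x :+ y)) refl w c (F T) (weightedSum R F))

weightedSum-𝔼 : ∀ {m A} (R : RTree m) (M : Mean A) (F : DTree m → A → ℚ) →
  weightedSum R (λ T → 𝔼 M (F T)) ≡ 𝔼 M (λ a → weightedSum R (λ T → F T a))
weightedSum-𝔼 [] M F = sym (const M 0ℚ)
weightedSum-𝔼 ((w , T) ∷ R) M F =
  trans (cong₂ _⊕_ (sym (scale M w (F T))) (weightedSum-𝔼 R M F)) (sym (add M _ _))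

-- Deciding `Finds` tree by tree produces the weight to which `IsSabotage` applies. A finding tree
-- adds nothing to the unseparated sum, any other at most its own weight.
subWeight : ∀ {m} (R : RTree m) → All (λ wt → 0ℚ ℚ.< proj₁ wt) R → ∀ v →
  ∃ λ s → SubWeight (left v) (right v) R s × weightedSum R (λ T → unseparated T v) ⊕ s ≼ weights R
subWeight [] [] v = 0ℚ , [] , ℚ.≤-refl
subWeight ((w , T) ∷ R) (0<w ∷ 0<ws) v with subWeight R 0<ws v | finds? T (left v) (right v)
... | s , sw , h | yes found = w ⊕ s , keep found sw , (begin
  w ⊛ unseparated T v ⊕ W ⊕ (w ⊕ s) ≡⟨ cong (λ z → w ⊛ z ⊕ W ⊕ (w ⊕ s)) (Finds⇒unseparated≡0 T v found) ⟩
  w ⊛ 0ℚ ⊕ W ⊕ (w ⊕ s)              ≡⟨ solve 3 (λ w x s → w :* con 0ℚ :+ x :+ (w :+ s) := w :+ (x :+ s)) refl w W s ⟩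
  w ⊕ (W ⊕ s)                       ≤⟨ ℚ.+-monoʳ-≤ w h ⟩
  w ⊕ weights R ∎)
  where
    open ℚ.≤-Reasoning
    W = weightedSum R (λ T → unseparated T v)
... | s , sw , h | no ¬found = s , skip ¬found sw , (begin
  w ⊛ unseparated T v ⊕ W ⊕ s       ≡⟨ ℚ.+-assoc (w ⊛ unseparated T v) W s ⟩
  w ⊛ unseparated T v ⊕ (W ⊕ s)     ≤⟨ ℚ.+-mono-≤ (*-monoˡ (ℚ.<⇒≤ 0<w) (unseparated≤1 T v)) h ⟩
  w ⊛ 1ℚ ⊕ weights R                ≡⟨ cong (_⊕ weights R) (ℚ.*-identityʳ w) ⟩
  w ⊕ weights R ∎)
  where
    open ℚ.≤-Reasoning
    W = weightedSum R (λ T → unseparated T v)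

module _ {m : ℕ} (g : BoolFun m) (R : RTree m) (dist : IsDistribution R) (sab : IsSabotage oneThird g R) where

  unseparated-weight₀₁ : ∀ v → g (left v) ≡ false → g (right v) ≡ true →
    weightedSum R (λ T → unseparated T v) ≼ oneThird
  unseparated-weight₀₁ v gx gy with subWeight R (proj₁ dist) v
  ... | s , sw , h = begin
    W                         ≡⟨ solve 2 (λ x s → x := x :+ s :- s) refl W s ⟩
    W ⊕ s ⊖ s                 ≤⟨ ℚ.+-mono-≤ (subst (W ⊕ s ≼_) (proj₂ dist) h) (ℚ.neg-antimono-≤ (sab (left v) (right v) gx gy s sw)) ⟩
    1ℚ ⊖ (1ℚ ⊖ oneThird)      ≡⟨⟩
    oneThird ∎
    where
      open ℚ.≤-Reasoning
      W = weightedSum R (λ T → unseparated T v)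

  unseparated-weight₁₀ : ∀ v → g (left v) ≡ true → g (right v) ≡ false →
    weightedSum R (λ T → unseparated T v) ≼ oneThird
  unseparated-weight₁₀ v gx gy = subst (_≼ oneThird) (weightedSum-cong R λ T → unseparated-swap T v)
    (unseparated-weight₀₁ (map swap v)
      (trans (cong g (sym (Vec.map-∘ proj₁ swap v))) gy) (trans (cong g (sym (Vec.map-∘ proj₂ swap v))) gx))

  disagree-weight : ∀ v →
    disagree g v ⊛ weightedSum R (λ T → unseparated T v) ≼ disagree g v ⊛ oneThird
  disagree-weight v with g (left v) in gx | g (right v) in gy
  ... | false | true = *-monoˡ 0≤1 (unseparated-weight₀₁ v gx gy)
  ... | true | false = *-monoˡ 0≤1 (unseparated-weight₁₀ v gx gy)
  ... | false | false = ℚ.≤-reflexive (trans (ℚ.*-zeroˡ (weightedSum R λ T → unseparated T v)) (sym (ℚ.*-zeroˡ oneThird)))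
  ... | true | true = ℚ.≤-reflexive (trans (ℚ.*-zeroˡ (weightedSum R λ T → unseparated T v)) (sym (ℚ.*-zeroˡ oneThird)))

  -- On each pair that disagrees under `g`, a fresh draw from `R` fails with weight at most one
  -- third, whatever `T` is; exchanging the sum with `𝔼 M` turns this into a bound for the average.
  confused-weight : ∀ (M : Mean (Vec (Bool × Bool) m)) T →
    weightedSum R (λ T′ → 𝔼 M (confused g (T ▷ T′))) ≼ oneThird ⊛ 𝔼 M (confused g T)
  confused-weight M T = begin
    weightedSum R (λ T′ → 𝔼 M (confused g (T ▷ T′)))          ≡⟨ weightedSum-𝔼 R M (λ T′ → confused g (T ▷ T′)) ⟩
    𝔼 M (λ v → weightedSum R (λ T′ → confused g (T ▷ T′) v))  ≡⟨ ext M (λ v → trans (weightedSum-cong R λ T′ → confused-▷ g T T′ v) (weightedSum-scale R (confused g T v) (λ T′ → unseparated T′ v))) ⟩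
    𝔼 M (λ v → confused g T v ⊛ W v)                          ≤⟨ mono M pointwise ⟩
    𝔼 M (λ v → oneThird ⊛ confused g T v)                     ≡⟨ scale M oneThird (confused g T) ⟩
    oneThird ⊛ 𝔼 M (confused g T) ∎
    where
      open ℚ.≤-Reasoning
      W : Vec (Bool × Bool) m → ℚ
      W v = weightedSum R (λ T′ → unseparated T′ v)
      pointwise : ∀ v → confused g T v ⊛ W v ≼ oneThird ⊛ confused g T v
      pointwise v = begin
        d ⊛ u ⊛ W v         ≡⟨ solve 3 (λ d u w → d :* u :* w := u :* (d :* w)) refl d u (W v) ⟩
        u ⊛ (d ⊛ W v)       ≤⟨ *-monoˡ (0≤unseparated T v) (disagree-weight v) ⟩
        u ⊛ (d ⊛ oneThird)  ≡⟨ solve 3 (λ d u w → u :* (d :* w) := w :* (d :* u)) refl d u oneThird ⟩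
        oneThird ⊛ (d ⊛ u) ∎
        where
          d = disagree g v
          u = unseparated T v

-- If the first tree exceeds `e`, deleting it leaves a list whose average is still at most `e`.
-- Comparing with `e` times the total weight makes the claim stable under passing to tails.
≤-average : ∀ {m} wt (R : RTree m) (F : DTree m → ℚ) e → All (λ wt → 0ℚ ℚ.< proj₁ wt) (wt ∷ R) →
  weightedSum (wt ∷ R) F ≼ e ⊛ weights (wt ∷ R) → ∃ λ T → depth T ≤ queryComplexity (wt ∷ R) × F T ≼ e
≤-average (w , T) R F e (0<w ∷ 0<ws) h with F T ℚ.≤? e
... | yes FT≤e = T , ℕ.m≤m⊔n (depth T) (queryComplexity R) , FT≤e
≤-average (w , T) [] F e (0<w ∷ []) h | no FT≰e = contradiction
  (ℚ.*-cancelˡ-≤-pos w {{positive 0<w}} (subst₂ _≼_ (ℚ.+-identityʳ (w ⊛ F T))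
    (trans (cong (e ⊛_) (ℚ.+-identityʳ w)) (ℚ.*-comm e w)) h)) FT≰e
≤-average (w , T) (wt ∷ R) F e (0<w ∷ 0<ws) h | no FT≰e =
  proj₁ rest , ℕ.≤-trans (proj₁ (proj₂ rest)) (ℕ.m≤n⊔m (depth T) (queryComplexity (wt ∷ R))) , proj₂ (proj₂ rest)
  where
    open ℚ.≤-Reasoning
    S = weightedSum (wt ∷ R) F
    W = weights (wt ∷ R)
    below : S ≼ e ⊛ W
    below = begin
      S                                  ≡⟨ solve 3 (λ s w e → s := w :* e :+ s :- w :* e) refl S w e ⟩
      w ⊛ e ⊕ S ⊖ w ⊛ e                  ≤⟨ ℚ.+-monoˡ-≤ (ℚ.- (w ⊛ e)) (ℚ.+-monoˡ-≤ S (*-monoˡ (ℚ.<⇒≤ 0<w) (ℚ.<⇒≤ (ℚ.≰⇒> FT≰e)))) ⟩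
      w ⊛ F T ⊕ S ⊖ w ⊛ e                ≤⟨ ℚ.+-monoˡ-≤ (ℚ.- (w ⊛ e)) h ⟩
      e ⊛ (w ⊕ W) ⊖ w ⊛ e                ≡⟨ solve 3 (λ s w e → e :* (w :+ s) :- w :* e := e :* s) refl W w e ⟩
      e ⊛ W ∎
    rest = ≤-average wt R F e 0<ws below

≤-mean : ∀ {m} (R : RTree m) (F : DTree m → ℚ) e → IsDistribution R →
  weightedSum R F ≼ e → ∃ λ T → depth T ≤ queryComplexity R × F T ≼ e
-- An empty list has total weight 0, not 1.
≤-mean [] F e (_ , ()) h
≤-mean (wt ∷ R) F e (0<ws , sum) h =
  ≤-average wt R F e 0<ws (subst (weightedSum (wt ∷ R) F ≼_) (sym (trans (cong (e ⊛_) sum) (ℚ.*-identityʳ e))) h)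

-- The method of conditional expectations, composing k trees of the support.
confused-tree : ∀ {m} (g : BoolFun m) R → IsDistribution R → IsSabotage oneThird g R →
  (M : Mean (Vec (Bool × Bool) m)) → ∀ k →
  ∃ λ T → depth T ≤ k * queryComplexity R × 𝔼 M (confused g T) ≼ pow oneThird k
confused-tree g R dist sab M zero = leaf false , ℕ.≤-refl ,
  subst (𝔼 M (confused g (leaf false)) ≼_) (const M 1ℚ)
    (mono M λ v → subst (_≼ 1ℚ) (sym (ℚ.*-identityʳ (disagree g v))) (differ≤1 (g (left v)) (g (right v))))
confused-tree g R dist sab M (suc k) = extend (confused-tree g R dist sab M k)
  where
    extend : (∃ λ T → depth T ≤ k * queryComplexity R × 𝔼 M (confused g T) ≼ pow oneThird k) →
      ∃ λ T → depth T ≤ suc k * queryComplexity R × 𝔼 M (confused g T) ≼ pow oneThird (suc k)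
    extend (T , depth-T , h) = compose (≤-mean R (λ T′ → 𝔼 M (confused g (T ▷ T′)))
        (oneThird ⊛ 𝔼 M (confused g T)) dist (confused-weight g R dist sab M T))
      where
        compose : (∃ λ T′ → depth T′ ≤ queryComplexity R × 𝔼 M (confused g (T ▷ T′)) ≼ oneThird ⊛ 𝔼 M (confused g T)) →
          ∃ λ T → depth T ≤ suc k * queryComplexity R × 𝔼 M (confused g T) ≼ pow oneThird (suc k)
        compose (T′ , depth-T′ , h′) = T ▷ T′ ,
          ℕ.≤-trans (depth-▷ T T′)
            (subst (_≤ suc k * queryComplexity R) (ℕ.+-comm (depth T′) (depth T)) (ℕ.+-mono-≤ depth-T′ depth-T)) ,
          ℚ.≤-trans h′ (*-monoˡ (ℚ.nonNegative⁻¹ oneThird) h)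

-- Numerical estimates.

ι : ℕ → ℚ
ι zero = 0ℚ
ι (suc n) = 1ℚ ⊕ ι n

0≤ι : ∀ n → 0ℚ ≼ ι n
0≤ι zero = ℚ.≤-refl
0≤ι (suc n) = 0≤+ 0≤1 (0≤ι n)

ι-+ : ∀ a b → ι (a + b) ≡ ι a ⊕ ι b
ι-+ zero b = sym (ℚ.+-identityˡ (ι b))
ι-+ (suc a) b = trans (cong (1ℚ ⊕_) (ι-+ a b)) (sym (ℚ.+-assoc 1ℚ (ι a) (ι b)))

ι-mono : ∀ {a b} → a ≤ b → ι a ≼ ι b
ι-mono {b = b} ℕ.z≤n = 0≤ι b
ι-mono (s≤s h) = ℚ.+-monoʳ-≤ 1ℚ (ι-mono h)

ι-2^ : ∀ t → ι (2 ^ t) ≡ pow 2ℚ t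
ι-2^ zero = ℚ.+-identityʳ 1ℚ
ι-2^ (suc t) = trans (ι-+ (2 ^ t) (2 ^ t + 0)) (trans
  (cong₂ _⊕_ (ι-2^ t) (trans (cong ι (ℕ.+-identityʳ (2 ^ t))) (ι-2^ t)))
  (solve 1 (λ x → x :+ x := con 2ℚ :* x) refl (pow 2ℚ t)))

pow-2-rate : ∀ t → pow 2ℚ t ⊛ val (rate t) ≡ 1ℚ
pow-2-rate zero = refl
pow-2-rate (suc t) = trans
  (solve 2 (λ a b → con 2ℚ :* a :* (b :* con ½) := a :* b) refl (pow 2ℚ t) (val (rate t))) (pow-2-rate t)

bernoulli-inequality : ∀ (q : Unit) K → 1ℚ ⊖ ι K ⊛ val q ≼ pow (1ℚ ⊖ val q) K
bernoulli-inequality q zero = ℚ.≤-reflexive (solve 1 (λ q → con 1ℚ :- con 0ℚ :* q := con 1ℚ) refl (val q))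
bernoulli-inequality q (suc K) = begin
  1ℚ ⊖ (1ℚ ⊕ ι K) ⊛ r
    ≡⟨ ℚ.+-identityʳ _ ⟨
  1ℚ ⊖ (1ℚ ⊕ ι K) ⊛ r ⊕ 0ℚ
    -- The added square term completes the product `(1 - r)(1 - K r)`.
    ≤⟨ ℚ.+-monoʳ-≤ (1ℚ ⊖ (1ℚ ⊕ ι K) ⊛ r) (0≤* (0≤ι K) (0≤* (0≤val q) (0≤val q))) ⟩
  1ℚ ⊖ (1ℚ ⊕ ι K) ⊛ r ⊕ ι K ⊛ (r ⊛ r)
    ≡⟨ solve 2 (λ k r → con 1ℚ :- (con 1ℚ :+ k) :* r :+ k :* (r :* r) := (con 1ℚ :- r) :* (con 1ℚ :- k :* r)) refl (ι K) r ⟩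
  (1ℚ ⊖ r) ⊛ (1ℚ ⊖ ι K ⊛ r)
    ≤⟨ *-monoˡ (≤⇒0≤- (val≤1 q)) (bernoulli-inequality q K) ⟩
  (1ℚ ⊖ r) ⊛ pow (1ℚ ⊖ r) K ∎
  where
    open ℚ.≤-Reasoning
    r = val q

-- `K` times the rate is at most one half, so the noise spares `K` given coordinates with
-- probability at least one half.
½≤pow : ∀ t K → K ≤ 2 ^ t → ½ ≼ pow (1ℚ ⊖ val (rate (suc t))) K
½≤pow t K K≤2^t = begin
  1ℚ ⊖ ½                            ≡⟨ cong (1ℚ ⊖_) (trans (cong (_⊛ ½) (pow-2-rate t)) (ℚ.*-identityˡ ½)) ⟨
  1ℚ ⊖ pow 2ℚ t ⊛ val (rate t) ⊛ ½  ≡⟨ cong (1ℚ ⊖_) (ℚ.*-assoc (pow 2ℚ t) (val (rate t)) ½) ⟩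
  1ℚ ⊖ pow 2ℚ t ⊛ q                 ≤⟨ ℚ.+-monoʳ-≤ 1ℚ (ℚ.neg-antimono-≤ (*-monoʳ (0≤val (rate (suc t))) (subst (ι K ≼_) (ι-2^ t) (ι-mono K≤2^t)))) ⟩
  1ℚ ⊖ ι K ⊛ q                      ≤⟨ bernoulli-inequality (rate (suc t)) K ⟩
  pow (1ℚ ⊖ q) K ∎
  where
    open ℚ.≤-Reasoning
    q = val (rate (suc t))

-- Each step multiplies the left side by 4/729. The target 1/96 is one half times one third over 16:
-- the half is the chance that the noise spares the queried coordinates, the third the allowed
-- error, and 16 the factor from the `4` in the exponent `s` of `shallow-tree`.
pow-decay : ∀ n → pow 2ℚ (suc n * 2) ⊛ pow oneThird (suc n * 6) ≼ ℤ.+ 1 ℚ./ 96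
pow-decay zero = toWitness {a? = pow 2ℚ 2 ⊛ pow oneThird 6 ℚ.≤? ℤ.+ 1 ℚ./ 96} _
pow-decay (suc n) = begin
  pow 2ℚ (suc (suc n) * 2) ⊛ pow oneThird (suc (suc n) * 6)
    ≡⟨ solve 4 (λ a b x y → a :* (a :* x) :* (b :* (b :* (b :* (b :* (b :* (b :* y))))))
         := (a :* a :* (b :* b :* b :* b :* b :* b)) :* (x :* y)) refl 2ℚ oneThird A B ⟩
  ratio ⊛ (A ⊛ B)
    ≤⟨ *-monoʳ (0≤* (0≤pow (suc n * 2) 0≤2) (0≤pow (suc n * 6) (ℚ.nonNegative⁻¹ oneThird))) (toWitness {a? = ratio ℚ.≤? 1ℚ} _) ⟩
  1ℚ ⊛ (A ⊛ B) ≡⟨ ℚ.*-identityˡ (A ⊛ B) ⟩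
  A ⊛ B ≤⟨ pow-decay n ⟩
  ℤ.+ 1 ℚ./ 96 ∎
  where
    open ℚ.≤-Reasoning
    A = pow 2ℚ (suc n * 2)
    B = pow oneThird (suc n * 6)
    ratio = 2ℚ ⊛ 2ℚ ⊛ (oneThird ⊛ oneThird ⊛ oneThird ⊛ oneThird ⊛ oneThird ⊛ oneThird)

-- Translation of `errorProb` and choice of parameters.

units : ∀ {m} (p : Vec ℚ m) → All (λ q → (0ℚ ≼ q) × (q ≼ 1ℚ)) (toList p) → Vec Unit m
units [] [] = []
units (p ∷ ps) ((0≤p , p≤1) ∷ hs) = unit p 0≤p p≤1 ∷ units ps hs

sum-++ : ∀ xs ys → sumℚ (xs ++ ys) ≡ sumℚ xs ⊕ sumℚ ys
sum-++ [] ys = sym (ℚ.+-identityˡ (sumℚ ys))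
sum-++ (x ∷ xs) ys = trans (cong (x ⊕_) (sum-++ xs ys)) (sym (ℚ.+-assoc x (sumℚ xs) (sumℚ ys)))

sum-scale : ∀ {A : Set} c (f : A → ℚ) xs → sumℚ (List.map (λ x → c ⊛ f x) xs) ≡ c ⊛ sumℚ (List.map f xs)
sum-scale c f [] = sym (ℚ.*-zeroʳ c)
sum-scale c f (x ∷ xs) = trans (cong (c ⊛ f x ⊕_) (sum-scale c f xs)) (sym (ℚ.*-distribˡ-+ c (f x) (sumℚ (List.map f xs))))

-- The cube splits on its first bit, whose probability factors out of each half. This turns
-- `errorProb` into `error`.
sum-probVec : ∀ {m} (p : Vec ℚ m) hs (F : Input m → ℚ) →
  sumℚ (List.map (λ x → probVec p x ⊛ F x) (allInputs m)) ≡ 𝔼 (product bernoulli (units p hs)) F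
sum-probVec [] [] F = trans (ℚ.+-identityʳ (1ℚ ⊛ F [])) (ℚ.*-identityˡ (F []))
sum-probVec {suc m} (p ∷ ps) (_ ∷ hs) F = trans (cong sumℚ (List.map-++ G (List.map (false ∷_) xs) (List.map (true ∷_) xs)))
  (trans (sum-++ (List.map G (List.map (false ∷_) xs)) (List.map G (List.map (true ∷_) xs)))
    (cong₂ _⊕_ (half false (1ℚ ⊖ p) λ _ → refl) (half true p λ _ → refl)))
  where
    xs = allInputs m
    G : Input (suc m) → ℚ
    G x = probVec (p ∷ ps) x ⊛ F x
    half : ∀ b c → (∀ x → probVec (p ∷ ps) (b ∷ x) ≡ c ⊛ probVec ps x) →
      sumℚ (List.map G (List.map (b ∷_) xs)) ≡ c ⊛ 𝔼 (product bernoulli (units ps hs)) (λ x → F (b ∷ x))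
    half b c eq = trans (cong sumℚ (trans (sym (List.map-∘ xs))
        (List.map-cong (λ x → trans (cong (_⊛ F (b ∷ x)) (eq x)) (ℚ.*-assoc c (probVec ps x) (F (b ∷ x)))) xs)))
      (trans (sum-scale c (λ x → probVec ps x ⊛ F (b ∷ x)) xs) (cong (c ⊛_) (sum-probVec ps hs λ x → F (b ∷ x))))

shallow-tree : ∀ {m} (g : BoolFun m) R → IsDistribution R → IsSabotage oneThird g R → (μ : ProdDist m) →
  ∀ n → queryComplexity R ≤ 2 ^ suc n →
  ∃ λ T → depth T ≤ suc n * 6 * queryComplexity R × errorProb μ T g ≼ oneThird
shallow-tree g R dist sab (p , hs) n r≤2^n = T* , subst (_≤ K) (sym (depth-relabel g T ps)) depth-T ,
  subst (_≼ oneThird) (sym (sum-probVec p hs λ x → differ (run T* x) (g x))) (ℚ.*-cancelˡ-≤-pos ½ (begin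
    ½ ⊛ e                                          ≤⟨ *-monoʳ 0≤e (½≤pow (3 + suc n * 2) K K≤) ⟩
    pow (1ℚ ⊖ val (rate s)) K ⊛ e                  ≤⟨ error-relabel g s T K ps depth-T ⟩
    pow 2ℚ s ⊛ 𝔼 (noise (rate s) ps) (confused g T) ≤⟨ *-monoˡ (0≤pow s 0≤2) h ⟩
    pow 2ℚ s ⊛ pow oneThird (suc n * 6)
      ≡⟨ solve 3 (λ a x y → a :* (a :* (a :* (a :* x))) :* y := (a :* a :* a :* a) :* (x :* y)) refl 2ℚ (pow 2ℚ (suc n * 2)) (pow oneThird (suc n * 6)) ⟩
    2ℚ ⊛ 2ℚ ⊛ 2ℚ ⊛ 2ℚ ⊛ (pow 2ℚ (suc n * 2) ⊛ pow oneThird (suc n * 6))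
      ≤⟨ *-monoˡ (0≤* (0≤* (0≤* 0≤2 0≤2) 0≤2) 0≤2) (pow-decay n) ⟩
    ½ ⊛ oneThird ∎))
  where
    open ℚ.≤-Reasoning
    ps = units p hs
    -- One more than the exponent in `K≤`, as `½≤pow` requires. It depends only on `n`, so the noise
    -- is fixed before the tree is chosen.
    s = 4 + suc n * 2
    tree = confused-tree g R dist sab (noise (rate s) ps) (suc n * 6)
    T = proj₁ tree
    depth-T = proj₁ (proj₂ tree)
    h = proj₂ (proj₂ tree)
    K = suc n * 6 * queryComplexity R
    T* = relabel g T ps
    e = error g T* ps
    0≤e : 0ℚ ≼ e
    0≤e = nonneg (product bernoulli ps) λ x → 0≤differ (run T* x) (g x)
    n<2^n : ∀ n → suc n ≤ 2 ^ n
    n<2^n zero = ℕ.≤-refl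
    n<2^n (suc n) = ℕ.+-mono-≤ (ℕ.m^n>0 2 n) (subst (suc n ≤_) (sym (ℕ.+-identityʳ (2 ^ n))) (n<2^n n))
    -- The product of `6 ≤ 8`, `suc n ≤ 2 ^ suc n` and `queryComplexity R ≤ 2 ^ suc n`.
    K≤ : K ≤ 2 ^ (3 + suc n * 2)
    K≤ = subst₂ _≤_ (lhs (suc n) (queryComplexity R))
      (trans (cong (8 *_) (trans (sym (ℕ.^-distribˡ-+-* 2 (suc n) (suc n))) (cong (2 ^_) (double (suc n)))))
        (sym (ℕ.^-distribˡ-+-* 2 3 (suc n * 2))))
      (ℕ.*-mono-≤ (ℕ.m≤m+n 6 2) (ℕ.*-mono-≤ (ℕ.<⇒≤ (n<2^n (suc n))) r≤2^n))
      where
        lhs : ∀ n r → 6 * (n * r) ≡ n * 6 * r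
        lhs n r = trans (sym (ℕ.*-assoc 6 n r)) (cong (_* r) (ℕ.*-comm 6 n))
        double : ∀ n → n + n ≡ n * 2
        double n = trans (cong (n +_) (sym (ℕ.+-identityʳ n))) (ℕ.*-comm 2 n)

1≤⌊log₂d+2⌋ : ∀ d → 1 ≤ ⌊log₂ (d + 2) ⌋
1≤⌊log₂d+2⌋ d = subst (_≤ ⌊log₂ (d + 2) ⌋) (⌊log₂[2^n]⌋≡n 1) (⌊log₂⌋-mono-≤ (ℕ.m≤n+m 2 d))

n<2^1+⌊log₂n⌋ : ∀ n → n ℕ.< 2 ^ suc ⌊log₂ n ⌋
n<2^1+⌊log₂n⌋ n = ℕ.≰⇒> λ h →
  ℕ.1+n≰n (subst (_≤ ⌊log₂ n ⌋) (⌊log₂[2^n]⌋≡n (suc ⌊log₂ n ⌋)) (⌊log₂⌋-mono-≤ h))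

-- `L` stands for the logarithm of `d + 2`. The loss in `shallow-tree` is logarithmic in the query
-- complexity `r`; if `d ≤ r` the bound is immediate, and otherwise `r ≤ d` bounds that loss through
-- `L`.
sabotage-bound : ∀ {m} (g : BoolFun m) R → IsDistribution R → IsSabotage oneThird g R → ∀ d → IsDprod g d →
  ∀ L → 1 ≤ L → d + 2 ℕ.< 2 ^ suc L → d ≤ 12 * queryComplexity R * (L ^ 1)
sabotage-bound g R dist sab d ((μ , _ , minimal) , _) (suc L) 1≤L d<2^L = cases (ℕ.≤-total d r)
  where
    r = queryComplexity R
    rearrange : ∀ L r → L * 2 * 6 * r ≡ 12 * r * (L ^ 1)
    rearrange L r = begin
      L * 2 * 6 * r        ≡⟨ cong (_* r) (ℕ.*-assoc L 2 6) ⟩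
      L * 12 * r           ≡⟨ ℕ.*-assoc L 12 r ⟩
      L * (12 * r)         ≡⟨ ℕ.*-comm L (12 * r) ⟩
      12 * r * L           ≡⟨ cong (12 * r *_) (ℕ.^-identityʳ L) ⟨
      12 * r * (L ^ 1) ∎
      where open ≡-Reasoning
    cases : d ≤ r ⊎ r ≤ d → d ≤ 12 * r * (suc L ^ 1)
    cases (inj₁ d≤r) =
      ℕ.≤-trans d≤r (ℕ.≤-trans (ℕ.m≤n*m r 12) (ℕ.m≤m*n (12 * r) (suc L ^ 1) {{ℕ.m^n≢0 (suc L) 1}}))
    -- The argument makes the number of composed trees `suc L * 2 * 6`, whence the constant 12.
    -- Doubling `suc L` absorbs the extra one in the exponent bounding `d + 2`.
    cases (inj₂ r≤d) = conclude (shallow-tree g R dist sab μ (suc (L * 2)) (ℕ.≤-trans r≤d (ℕ.≤-trans (ℕ.m≤m+n d 2)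
        (ℕ.≤-trans (ℕ.<⇒≤ d<2^L) (ℕ.^-monoʳ-≤ 2 (s≤s (s≤s (ℕ.m≤m*n L 2))))))))
      where
        conclude : (∃ λ T → depth T ≤ suc L * 2 * 6 * r × errorProb μ T g ≼ oneThird) → d ≤ 12 * r * (suc L ^ 1)
        conclude (T , depth-T , err) =
          ℕ.≤-trans (minimal (depth T) (T , refl , err)) (subst (depth T ≤_) (rearrange (suc L) r) depth-T)

theorem1 : ∃₂ λ (c k : ℕ) →
    ∀ (m : ℕ) (g : BoolFun m) (d r : ℕ) → IsDprod g d → IsRS g r →
    d ≤ c * r * (⌊log₂ (d + 2) ⌋ ^ k)
theorem1 = 12 , 1 , λ { m g d _ Dprod ((R , dist , sab , refl) , _) →
  sabotage-bound g R dist sab d Dprod ⌊log₂ (d + 2) ⌋ (1≤⌊log₂d+2⌋ d) (n<2^1+⌊log₂n⌋ (d + 2)) }
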